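{- The restricted map $\alpha:\mathcal{T}\to\hat{\mathcal{A}}$ and its inverse map $\bar\alpha:\hat{\mathcal{A}}\to\mathcal{T}$ are size-preserving bijections between Fishburn trees and modified ascent sequences. In particular, for each $n\ge1$ we have $|\mathcal{T}_n|=|\hat{\mathcal{A}}_n|$.
   Context: Write $[n]=\{1,\dots,n\}$. A binary tree is either empty or a triple $T=(L,r,R)$ with $r$ a node (the root) and $L,R$ binary trees (left and right subtree). $V(T)$ is the set of nodes and the size of $T$ is $|V(T)|$. A vertex labeling is a map $\mathfrak{l}:V(T)\to\{1,2,\dots\}$; $\max(T)$ is the largest label, with $\max(\emptyset)=0$. Labeled binary trees are considered up to label-preserving isomorphism of binary trees. $T$ is decreasing if it is empty, or $T=(L,r,R)$ with $L,R$ decreasing and $\mathfrak{l}(r)\ge\max\{\max(L),\max(R)\}$. $T$ is strictly decreasing to the left if it is empty, or $T=(L,r,R)$ with $\mathfrak{l}(r)>\max(L)$ and $L,R$ strictly decreasing to the left. An endotree of size $n$ is a decreasing binary tree of size $n$ that is strictly decreasing to the left and has all labels in $[n]$; it is regular if the set of its labels equals $[k]$ for some $k\le n$. The in-order traversal of $T=(L,r,R)$ traverses $L$ recursively, then visits $r$, then traverses $R$ recursively; $v_i$ is the $i$-th visited node. Put $\mathrm{asctops}(T)=\{v_1\}\cup\{v_i: v_i\text{ has a left child}\}$ and $\mathrm{nub}(T)=\{v_j:\mathfrak{l}(v_i)\ne\mathfrak{l}(v_j)\text{ for each }i<j\}$ (both empty for the empty tree). A Fishburn tree is a regular endotree $T$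 with $\mathrm{nub}(T)=\mathrm{asctops}(T)$; $\mathcal{T}$ is the set of Fishburn trees and $\mathcal{T}_n$ the set of those of size $n$. The in-order sequence of $T$ is $\alpha(T)=\mathfrak{l}(v_1)\mathfrak{l}(v_2)\dots\mathfrak{l}(v_n)$. For a word $x=x_1\dots x_n$ of positive integers, $\bar\alpha(x)$ is the empty tree if $x$ is empty; otherwise, letting $m$ be the index of the leftmost occurrence of $\max_i x_i$, $\bar\alpha(x)=(L,r,R)$ with $\mathfrak{l}(r)=x_m$, $L=\bar\alpha(x_1\dots x_{m-1})$, $R=\bar\alpha(x_{m+1}\dots x_n)$. A Cayley permutation of size $n$ is a word $x=x_1\dots x_n$ (a map $x:[n]\to[n]$) whose set of values is $[k]$ for some $k\le n$. For $x:[n]\to[n]$ put $\mathrm{asctops}(x)=\{(1,x_1)\}\cup\{(i,x_i):1<i\le n,\ x_{i-1}<x_i\}$ and $\mathrm{nub}(x)=\{(\min x^{ -1}(j),j):1\le j\le\max(x)\}$ (both empty for the empty word; for a general endofunction only values $j$ that occur are considered). The set of modified ascent sequences is $\hat{\mathcal{A}}=\{x\text{ a Cayley permutation}:\mathrm{asctops}(x)=\mathrm{nub}(x)\}$, and $\hat{\mathcal{A}}_n$ is the set of those of size $n$. -}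

module Defs where

open import Data.Empty using (⊥-elim)
open import Data.Fin as Fin using (Fin; zero; suc; toℕ)
open import Data.Fin.Properties using (toℕ<n)
open import Data.List using (List; []; _∷_; _++_; map; foldr; length; lookup; take; drop)
open import Data.List.Membership.Propositional using (_∈_)
open import Data.List.Membership.Propositional.Properties using (foldr-selective)
open import Data.List.Properties using (length-take; length-drop)
open import Data.List.Relation.Unary.Any using (here; there)
open import Data.Nat using (ℕ; suc; _≤_; _<_; _≥_; _>_; z≤n; s≤s; _≟_; _⊔_)
open import Data.Nat.Induction using (<-wellFounded)
open import Data.Nat.Properties
  using (≤-<-trans; ≤-trans; ≤-reflexive; m⊓n≤m; m∸n≤m; n≤0⇒n≡0; m≤m⊔n; ⊔-sel)
open import Data.Product using (∃; _×_; _,_; proj₁)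
open import Data.Sum using (_⊎_; inj₁; inj₂)
open import Data.Tree.Binary using (Tree; leaf; node; #nodes)
open import Data.Unit using (⊤; tt)
open import Function using (_on_)
open import Function.Bundles using (Inverse)
open import Induction.WellFounded using (Acc; acc)
open import Level using (Level) renaming (_⊔_ to _⊔ˡ_)
open import Relation.Binary.Bundles using (Setoid)
open import Relation.Binary.Core using (Rel)
import Relation.Binary.Construct.On as On
open import Relation.Binary.PropositionalEquality using (_≡_; _≢_; sym; trans; setoid)
open import Relation.Nullary using (yes; no)
open import Relation.Unary using (Pred; _⊆_; _≐_)

private
  variable
    a p : Level
    A : Set a

[1…_] : ℕ → Pred ℕ _
[1… k ] j = 1 ≤ j × j ≤ k

-- Equality of elements of a subset: membership proofs are ignored.
_≋_ : {P : Pred A p} → Rel (∃ P) _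
_≋_ = _≡_ on proj₁

subsetoid : {A : Set a} → Pred A p → Setoid (a ⊔ˡ p) a
subsetoid {A = A} P = On.setoid (setoid A) (proj₁ {B = P})

HasCardinality : {A : Set a} → Pred A p → ℕ → Set (a ⊔ˡ p)
HasCardinality P N = Inverse (subsetoid P) (setoid (Fin N))

-- Positions in words, and indices of nodes in the in-order traversal, are
-- elements of Fin n and hence counted from 0 rather than from 1.

IsMin : ∀ {n} → Pred (Fin n) p → Pred (Fin n) p
IsMin S i = S i × (∀ {i′} → S i′ → i Fin.≤ i′)

-- A node carries its label, so propositional equality of these trees is
-- label-preserving isomorphism.  Labels are arbitrary naturals here; the
-- definition of an endotree forces them to be positive.
LTree : Set
LTree = Tree ℕ ⊤

pattern ∅ = leaf tt

data Node : LTree → Set where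
  root  : ∀ {L m R} → Node (node L m R)
  left  : ∀ {L m R} → Node L → Node (node L m R)
  right : ∀ {L m R} → Node R → Node (node L m R)

label : ∀ {T} → Node T → ℕ
label (root {m = m}) = m
label (left v)       = label v
label (right v)      = label v

leftSubtree : ∀ {T} → Node T → LTree
leftSubtree (root {L = L}) = L
leftSubtree (left v)       = leftSubtree v
leftSubtree (right v)      = leftSubtree v

HasLeftChild : ∀ {T} → Pred (Node T) _
HasLeftChild v = leftSubtree v ≢ ∅

maxLabel : LTree → ℕ
maxLabel ∅            = 0
maxLabel (node L m R) = m ⊔ (maxLabel L ⊔ maxLabel R)

Decreasing : Pred LTree _
Decreasing ∅            = ⊤
Decreasing (node L m R) =
  Decreasing L × Decreasing R × m ≥ maxLabel L ⊔ maxLabel R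

StrictlyDecreasingLeft : Pred LTree _
StrictlyDecreasingLeft ∅            = ⊤
StrictlyDecreasingLeft (node L m R) =
  m > maxLabel L × StrictlyDecreasingLeft L × StrictlyDecreasingLeft R

Labels : LTree → Pred ℕ _
Labels T j = ∃ λ (v : Node T) → label v ≡ j

IsEndotree : Pred LTree _
IsEndotree T =
  Decreasing T × StrictlyDecreasingLeft T × Labels T ⊆ [1… #nodes T ]

IsRegular : Pred LTree _
IsRegular T = ∃ λ k → k ≤ #nodes T × Labels T ≐ [1… k ]

inorder : ∀ T → List (Node T)
inorder ∅            = []
inorder (node L m R) = map left (inorder L) ++ root ∷ map right (inorder R)

visited : ∀ T → Fin (length (inorder T)) → Node T
visited T = lookup (inorder T)

asctopsᵀ : ∀ T → Pred (Node T) _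
asctopsᵀ T v = (∃ λ i → toℕ i ≡ 0 × visited T i ≡ v) ⊎ HasLeftChild v

nubᵀ : ∀ T → Pred (Node T) _
nubᵀ T v = ∃ λ j → visited T j ≡ v ×
  (∀ i → i Fin.< j → label (visited T i) ≢ label (visited T j))

𝒯 : Pred LTree _
𝒯 T = IsEndotree T × IsRegular T × nubᵀ T ≐ asctopsᵀ T

𝒯ₙ : ℕ → Pred LTree _
𝒯ₙ n T = 𝒯 T × #nodes T ≡ n

Word : Set
Word = List ℕ

maximum : Word → ℕ
maximum = foldr _⊔_ 0

fibre : (x : Word) → ℕ → Pred (Fin (length x)) _
fibre x j i = lookup x i ≡ j

IsCayley : Pred Word _
IsCayley x = ∃ λ k → k ≤ length x × (_∈ x) ≐ [1… k ]

asctopsᵂ : (x : Word) → Pred (Fin (length x) × ℕ) _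
asctopsᵂ x (i , j) = lookup x i ≡ j ×
  (toℕ i ≡ 0 ⊎ (∃ λ i′ → toℕ i ≡ suc (toℕ i′) × lookup x i′ < lookup x i))

nubᵂ : (x : Word) → Pred (Fin (length x) × ℕ) _
nubᵂ x (i , j) = [1… maximum x ] j × IsMin (fibre x j) i

𝒜̂ : Pred Word _
𝒜̂ x = IsCayley x × asctopsᵂ x ≐ nubᵂ x

𝒜̂ₙ : ℕ → Pred Word _
𝒜̂ₙ n x = 𝒜̂ x × length x ≡ n

α : LTree → Word
α T = map label (inorder T)

leftmost : ∀ {j x} → j ∈ x → ∃ (IsMin (fibre x j))
leftmost {j} {b ∷ x} j∈ with b ≟ j
leftmost             j∈         | yes b≡j = zero , b≡j , λ _ → z≤n
leftmost             (here j≡b) | no  b≢j = ⊥-elim (b≢j (sym j≡b))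
leftmost {j} {b ∷ x} (there j∈) | no  b≢j with leftmost j∈
... | i , i∈ , i≤ = suc i , i∈ , least
  where
  least : ∀ {i′} → fibre (b ∷ x) j i′ → suc i Fin.≤ i′
  least {zero}   b≡j = ⊥-elim (b≢j b≡j)
  least {suc i′} i′∈ = s≤s (i≤ i′∈)

maximum∈ : ∀ b x → maximum (b ∷ x) ∈ b ∷ x
maximum∈ b x with foldr-selective ⊔-sel 0 (b ∷ x)
... | inj₂ m∈  = m∈
... | inj₁ m≡0 = here (trans m≡0 (sym (n≤0⇒n≡0
  (≤-trans (m≤m⊔n b (maximum x)) (≤-reflexive m≡0)))))

leftmostMax : ∀ b x → ∃ (IsMin (fibre (b ∷ x) (maximum (b ∷ x))))
leftmostMax b x = leftmost (maximum∈ b x)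

length-take-< : (x : Word) (m : Fin (length x)) → length (take (toℕ m) x) < length x
length-take-< x m = ≤-<-trans
  (≤-trans (≤-reflexive (length-take (toℕ m) x)) (m⊓n≤m (toℕ m) (length x)))
  (toℕ<n m)

length-drop-< : (b : ℕ) (x : Word) (k : ℕ) → length (drop (suc k) (b ∷ x)) < length (b ∷ x)
length-drop-< b x k =
  s≤s (≤-trans (≤-reflexive (length-drop k x)) (m∸n≤m (length x) k))

ᾱ-acc : (x : Word) → Acc _<_ (length x) → LTree
ᾱ-acc []         _         = ∅
ᾱ-acc x@(b ∷ x′) (acc rec) =
  let m , _ = leftmostMax b x′ in
  node (ᾱ-acc (take (toℕ m) x)       (rec (length-take-< x m)))
       (lookup x m)
       (ᾱ-acc (drop (suc (toℕ m)) x) (rec (length-drop-< b x′ (toℕ m))))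

ᾱ : Word → LTree
ᾱ x = ᾱ-acc x (<-wellFounded (length x))

{-# OPTIONS --safe #-}
-- Read in in-order, a node with a left child is preceded by a node of its left
-- subtree, whose label is strictly smaller, while a node without one is preceded
-- (if at all) by the ancestor whose right subtree it begins, whose label is at
-- least as large.  So in a decreasing tree that is strictly decreasing to the left
-- the nodes in asctops are exactly the positions of the ascent tops of α(T), and
-- nub translates directly.  Splitting a word at its leftmost maximum recovers the
-- root, so α and ᾱ are mutually inverse.  For the cardinalities, membership in 𝒜̂
-- is decidable and 𝒜̂ₙ lies among the words of length n with letters at most n.

module Submission where

open import Defs
open import Data.Fin as Fin using (Fin; zero; suc; toℕ; cast)
import Data.Fin.Properties as Fin
open import Data.List
  using (List; []; _∷_; _++_; map; length; lookup; take; drop; head; last;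
         filter; deduplicate; upTo; cartesianProductWith)
open import Data.List.Membership.DecPropositional using (_∈?_)
open import Data.List.Membership.Propositional using (_∈_)
open import Data.List.Membership.Propositional.Properties
  using (∈-++⁺ˡ; ∈-++⁺ʳ; ∈-map⁺; ∈-map⁻; ∈-lookup; ∈-filter⁺; ∈-filter⁻;
         ∈-deduplicate⁺; ∈-upTo⁺; ∈-cartesianProductWith⁺)
open import Data.List.Properties
  using (map-++; map-∘; length-map; head-map; last-map; length-++;
         foldr-forcesᵇ; foldr-preservesᵇ; ≡-dec)
open import Data.List.Relation.Unary.All as All using (All; []; _∷_)
import Data.List.Relation.Unary.All.Properties as All
open import Data.List.Relation.Unary.AllPairs using ([]; _∷_)
open import Data.List.Relation.Unary.Any using (here; there; index)
open import Data.List.Relation.Unary.Any.Properties using (lookup-index)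
open import Data.List.Relation.Unary.Linked using (Linked; []; [-]; _∷_; _∷′_)
import Data.List.Relation.Unary.Linked.Properties as Linked
open import Data.List.Relation.Unary.Unique.DecPropositional.Properties using (deduplicate-!)
open import Data.List.Relation.Unary.Unique.Propositional using (Unique)
import Data.List.Relation.Unary.Unique.Propositional.Properties as Unique
open import Data.Maybe using (just; nothing)
open import Data.Maybe.Relation.Binary.Connected using (Connected; just; just-nothing; nothing-just)
import Data.Maybe.Relation.Unary.All as Maybe
open import Data.Nat using (ℕ; zero; suc; _≤_; _<_; _≤?_; _<?_; _≟_; z≤n; s≤s; s≤s⁻¹; pred; _+_; _⊔_)
open import Data.Nat.Induction using (<-wellFounded)
open import Data.Nat.Properties
  using (≤-refl; ≤-trans; ≤-<-trans; ≤-antisym; <⇒≱; <⇒≤; <⇒≢;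
         ≤∧≢⇒<; ≮⇒≥; ⊔-lub; m⊔n≤o⇒m≤o; m⊔n≤o⇒n≤o; m≤m⊔n; m≤n⊔m; allUpTo?; anyUpTo?)
open import Data.Product as Product using (Σ-syntax; ∃; _×_; _,_; proj₁; proj₂)
open import Data.Sum using (_⊎_; inj₁; inj₂)
open import Data.Tree.Binary using (#nodes; node)
open import Data.Unit using (tt)
open import Function using (_∘_; _⇔_; mk⇔; Equivalence)
open import Function.Bundles using (Inverse)
open import Function.Consequences using (inverseᵇ⇒bijective)
open import Function.Construct.Composition using (inverse)
open import Function.Definitions using (Bijective; Inverseᵇ)
open import Induction.WellFounded using (acc)
open import Level using (Level)
open import Relation.Binary.Definitions using (DecidableEquality)
open import Relation.Binary.PropositionalEquality
  using (_≡_; _≢_; refl; sym; trans; cong; cong₂; subst; subst₂; module ≡-Reasoning)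
open import Relation.Nullary using (Dec; contradiction)
open import Relation.Nullary.Decidable using (map′; _×-dec_; _⊎-dec_; _→-dec_)
open import Relation.Unary using (Pred; Decidable; _⊆_; _≐_; _⊢_)

open Equivalence using (to; from)

private
  variable
    a p q r : Level
    A B : Set a

-- Auxiliary facts on lists, labels and letters.

lookup-injective : {xs : List A} → Unique xs →
  ∀ {i j} → lookup xs i ≡ lookup xs j → i ≡ j
lookup-injective (_   ∷ _)  {zero}  {zero}  _  = refl
lookup-injective (x∉  ∷ _)  {zero}  {suc j} eq = contradiction eq (All.lookup x∉ (∈-lookup j))
lookup-injective (x∉  ∷ _)  {suc i} {zero}  eq = contradiction (sym eq) (All.lookup x∉ (∈-lookup i))
lookup-injective (_   ∷ xs) {suc i} {suc j} eq = cong suc (lookup-injective xs eq)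

lookup-map : (f : A → B) (xs : List A) (i : Fin (length (map f xs))) →
  lookup (map f xs) i ≡ f (lookup xs (cast (length-map f xs) i))
lookup-map f (x ∷ xs) zero    = refl
lookup-map f (x ∷ xs) (suc i) = lookup-map f xs i

linked-lookup : {R : A → A → Set r} {xs : List A} → Linked R xs →
  ∀ {i j} → toℕ j ≡ suc (toℕ i) → R (lookup xs i) (lookup xs j)
linked-lookup [-]         {zero}  {zero}        ()
linked-lookup (Rxy ∷ _)   {zero}  {suc zero}    _  = Rxy
linked-lookup (_   ∷ Rxs) {suc i} {suc j}       eq = linked-lookup Rxs (cong pred eq)

take++lookup∷drop : (xs : List A) (i : Fin (length xs)) →
  take (toℕ i) xs ++ lookup xs i ∷ drop (suc (toℕ i)) xs ≡ xs
take++lookup∷drop (x ∷ xs) zero    = refl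
take++lookup∷drop (x ∷ xs) (suc i) = cong (x ∷_) (take++lookup∷drop xs i)

maxLabel-least : ∀ {c} T → (∀ (v : Node T) → label v ≤ c) → maxLabel T ≤ c
maxLabel-least ∅            _ = z≤n
maxLabel-least (node L m R) h = ⊔-lub (h root)
  (⊔-lub (maxLabel-least L (h ∘ left)) (maxLabel-least R (h ∘ right)))

label≤maxLabel : ∀ {T} (v : Node T) → label v ≤ maxLabel T
label≤maxLabel (root {L} {m} {R})    = m≤m⊔n m _
label≤maxLabel (left {L} {m} {R} v)  = ≤-trans (label≤maxLabel v)
  (≤-trans (m≤m⊔n _ (maxLabel R)) (m≤n⊔m m _))
label≤maxLabel (right {L} {m} {R} v) = ≤-trans (label≤maxLabel v)
  (≤-trans (m≤n⊔m (maxLabel L) _) (m≤n⊔m m _))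

letters≤maximum : ∀ x → All (_≤ maximum x) x
letters≤maximum x =
  foldr-forcesᵇ (λ m n m⊔n≤ → m⊔n≤o⇒m≤o m n m⊔n≤ , m⊔n≤o⇒n≤o m n m⊔n≤) 0 x ≤-refl

-- In-order traversal

∈-inorder : ∀ {T} (v : Node T) → v ∈ inorder T
∈-inorder root              = ∈-++⁺ʳ _ (here refl)
∈-inorder (left v)          = ∈-++⁺ˡ (∈-map⁺ left (∈-inorder v))
∈-inorder (right {L = L} v) =
  ∈-++⁺ʳ (map left (inorder L)) (there (∈-map⁺ right (∈-inorder v)))

left-injective : ∀ {L m R} {u v : Node L} → left {L} {m} {R} u ≡ left v → u ≡ v
left-injective refl = refl

right-injective : ∀ {L m R} {u v : Node R} → right {L} {m} {R} u ≡ right v → u ≡ v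
right-injective refl = refl

inorder-unique : ∀ T → Unique (inorder T)
inorder-unique ∅            = []
inorder-unique (node L m R) = Unique.++⁺
  (Unique.map⁺ left-injective (inorder-unique L))
  (All.map⁺ (All.universal (λ _ ()) (inorder R)) ∷
    Unique.map⁺ right-injective (inorder-unique R))
  disjoint
  where
  disjoint : ∀ {v} → v ∈ map left (inorder L) × v ∈ root ∷ map right (inorder R) → _
  disjoint (v∈L , here refl)  with () ← proj₂ (proj₂ (∈-map⁻ left v∈L))
  disjoint (v∈L , there v∈R)  with _ , _ , refl ← ∈-map⁻ left v∈L
                              with () ← proj₂ (proj₂ (∈-map⁻ right v∈R))

node⇒≢∅ : ∀ {T} → Node T → T ≢ ∅
node⇒≢∅ () refl

inorder-empty : ∀ {T} → inorder T ≡ [] → T ≡ ∅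
inorder-empty {∅}          _  = refl
inorder-empty {node L m R} eq with () ← subst (root ∈_) eq (∈-inorder root)

-- The traversal keeps descending to the left before its first visit, so it starts at the end of the
-- left spine.
first-visited-leftless : ∀ T →
  Maybe.All (λ v → leftSubtree v ≡ ∅) (head (inorder T))
first-visited-leftless ∅            = Maybe.nothing
first-visited-leftless (node L m R) with inorder L in eq | first-visited-leftless L
... | []    | _                = Maybe.just (inorder-empty eq)
... | _ ∷ _ | Maybe.just v≡∅   = Maybe.just v≡∅

-- Meant for consecutive nodes `u`, `v` of the traversal; the form of a binary relation lets
-- `Linked` assert it of all adjacent pairs at once.
LeftIffAscent : ∀ {T} → Node T → Node T → Set
LeftIffAscent u v = HasLeftChild v ⇔ label u < label v

-- An adjacent pair lies inside `L`, lies inside `R`, or contains the root. Induction settles the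
-- first two cases; strictness on the left and weak decrease on the right settle the pairs ending
-- and starting at the root.
adjacent-ascent : ∀ T → Decreasing T → StrictlyDecreasingLeft T →
  Linked LeftIffAscent (inorder T)
adjacent-ascent ∅ _ _ = []
adjacent-ascent (node L m R) (decL , decR , m≥) (m> , sdlL , sdlR) = Linked.++⁺
  (Linked.map⁺ (adjacent-ascent L decL sdlL))
  beforeRoot
  (afterRoot ∷′ Linked.map⁺ (adjacent-ascent R decR sdlR))
  where
  beforeRoot : Connected (LeftIffAscent {node L m R}) (last (map left (inorder L))) (just root)
  beforeRoot rewrite last-map (left {L} {m} {R}) (inorder L) with last (inorder L)
  ... | nothing = nothing-just
  -- Both sides hold: `L` contains `v`, and `label v` is at most `maxLabel L`, which is below `m`.
  ... | just v  = just (mk⇔ (λ _ → ≤-<-trans (label≤maxLabel v) m>) (λ _ → node⇒≢∅ v))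

  afterRoot : Connected (LeftIffAscent {node L m R}) (just root) (head (map right (inorder R)))
  afterRoot rewrite head-map {f = right {L} {m} {R}} (inorder R)
    with head (inorder R) | first-visited-leftless R
  ... | nothing | _              = just-nothing
  -- Both sides fail: `v` comes first in `R`, and its label is at most `m`.
  ... | just v  | Maybe.just v≡∅ = just (mk⇔ (contradiction v≡∅)
    (contradiction (≤-trans (label≤maxLabel v) (m⊔n≤o⇒n≤o (maxLabel L) _ m≥)) ∘ <⇒≱))

length-inorder : ∀ T → length (inorder T) ≡ #nodes T
length-inorder ∅            = refl
length-inorder (node L m R) = begin
  length (map left (inorder L) ++ root ∷ map right (inorder R))
    ≡⟨ length-++ (map left (inorder L)) ⟩
  length (map (left {L} {m} {R}) (inorder L)) + suc (length (map (right {L} {m} {R}) (inorder R)))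
    ≡⟨ cong₂ (λ k l → k + suc l) (trans (length-map left (inorder L)) (length-inorder L))
                                 (trans (length-map right (inorder R)) (length-inorder R)) ⟩
  #nodes L + suc (#nodes R) ∎
  where open ≡-Reasoning

length-α : ∀ T → length (α T) ≡ #nodes T
length-α T = trans (length-map label (inorder T)) (length-inorder T)

α-node : ∀ L m R → α (node L m R) ≡ α L ++ m ∷ α R
α-node L m R = trans (map-++ label (map left (inorder L)) _)
  (cong₂ (λ l r → l ++ m ∷ r) (sym (map-∘ (inorder L))) (sym (map-∘ (inorder R))))

label∈α : ∀ {T} (v : Node T) → label v ∈ α T
label∈α v = ∈-map⁺ label (∈-inorder v)

Labels≐α : ∀ T → Labels T ≐ (_∈ α T)
Labels≐α T = (λ { (v , refl) → label∈α v })
           , (λ j∈ → let v , _ , j≡ = ∈-map⁻ label j∈ in v , sym j≡)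

-- The maps α and ᾱ are mutually inverse

-- Since `l` avoids `j`, the displayed `j` is its first occurrence, so cutting at the minimal index
-- returns `l` and `r`.
leftmost-unique : ∀ {j r} l → All (_≢ j) l → ∀ {i} → IsMin (fibre (l ++ j ∷ r) j) i →
  take (toℕ i) (l ++ j ∷ r) ≡ l × drop (suc (toℕ i)) (l ++ j ∷ r) ≡ r
leftmost-unique []      _          {zero}  _             = refl , refl
leftmost-unique []      _          {suc i} (_ , least)   with () ← least {zero} refl
leftmost-unique (b ∷ l) (b≢j ∷ _)  {zero}  (b≡j , _)     = contradiction b≡j b≢j
leftmost-unique (b ∷ l) (_ ∷ l≢j)  {suc i} (i∈ , least)  =
  Product.map₁ (cong (b ∷_))
    (leftmost-unique l l≢j (i∈ , λ {i′} i′∈ → s≤s⁻¹ (least {suc i′} i′∈)))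

before-leftmost : ∀ {j} x {i} → IsMin (fibre x j) i → All (_≢ j) (take (toℕ i) x)
before-leftmost (b ∷ x) {zero}  _            = []
before-leftmost (b ∷ x) {suc i} (i∈ , least) =
  (λ b≡j → contradiction (least {zero} b≡j) λ ()) ∷
  before-leftmost x (i∈ , λ {i′} i′∈ → s≤s⁻¹ (least {suc i′} i′∈))

maximum-split : ∀ l m r → All (_< m) l → All (_≤ m) r → maximum (l ++ m ∷ r) ≡ m
maximum-split l m r l<m r≤m = ≤-antisym
  (foldr-preservesᵇ ⊔-lub z≤n (All.++⁺ (All.map <⇒≤ l<m) (≤-refl ∷ r≤m)))
  (All.lookup (letters≤maximum (l ++ m ∷ r)) (∈-++⁺ʳ l (here refl)))

-- In-order reading glues the two pieces back around the letter at which the word was cut. An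
-- arbitrary `rec` covers the accessibility proofs that arise in the recursive calls.
α-ᾱ-acc : ∀ x rec → α (ᾱ-acc x rec) ≡ x
α-ᾱ-acc []        _         = refl
α-ᾱ-acc x@(b ∷ x′) (acc rec) = trans (α-node _ _ _)
  (trans (cong₂ (λ l r → l ++ lookup x i ∷ r) (α-ᾱ-acc _ _) (α-ᾱ-acc _ _))
         (take++lookup∷drop x i))
  where i = proj₁ (leftmostMax b x′)

α-ᾱ : ∀ x → α (ᾱ x) ≡ x
α-ᾱ x = α-ᾱ-acc x _

leftmost-max-split : ∀ l m r → All (_< m) l → All (_≤ m) r →
  ∀ x → x ≡ l ++ m ∷ r → ∀ i → IsMin (fibre x (maximum x)) i →
  take (toℕ i) x ≡ l × lookup x i ≡ m × drop (suc (toℕ i)) x ≡ r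
leftmost-max-split l m r l<m r≤m x refl i i-min
  rewrite maximum-split l m r l<m r≤m =
  let take≡ , drop≡ = leftmost-unique l (All.map <⇒≢ l<m) i-min
  in take≡ , proj₁ i-min , drop≡

α-letters : ∀ T → All (_≤ maxLabel T) (α T)
α-letters T = All.map⁺ (All.universal label≤maxLabel (inorder T))

-- The two tree conditions make the root label the leftmost maximum of the in-order word, so the cut
-- separates exactly `α L` from `α R`. The word is a variable `x` with an equation, because `ᾱ-acc`
-- unfolds only on a visible cons and the recursive calls receive `take` and `drop` pieces.
ᾱ-acc-α : ∀ T → Decreasing T → StrictlyDecreasingLeft T →
  ∀ x → x ≡ α T → ∀ rec → ᾱ-acc x rec ≡ T
ᾱ-acc-α ∅ _ _ [] _ _ = refl
ᾱ-acc-α ∅ _ _ (_ ∷ _) () _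
ᾱ-acc-α (node L m R) _ _ [] []≡ _
  with () ← subst (m ∈_) (sym []≡) (label∈α {node L m R} root)
ᾱ-acc-α (node L m R) (decL , decR , m≥) (m> , sdlL , sdlR) x@(b ∷ x′) x≡ (acc rec) =
  let i , i-min = leftmostMax b x′
      take≡ , lookup≡ , drop≡ = leftmost-max-split (α L) m (α R)
        (All.map (λ ≤max → ≤-<-trans ≤max m>) (α-letters L))
        (All.map (λ ≤max → ≤-trans ≤max (m⊔n≤o⇒n≤o (maxLabel L) _ m≥)) (α-letters R))
        x (trans x≡ (α-node L m R)) i i-min
  in trans (cong₂ (λ l r → node l _ r) (ᾱ-acc-α L decL sdlL _ take≡ _)
                                       (ᾱ-acc-α R decR sdlR _ drop≡ _))
           (cong (λ k → node L k R) lookup≡)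

ᾱ-α : ∀ T → Decreasing T → StrictlyDecreasingLeft T → ᾱ (α T) ≡ T
ᾱ-α T dec sdl = ᾱ-acc-α T dec sdl (α T) refl _

-- By `α-ᾱ-acc`, every label of the tree is a letter of the word.
maxLabel-ᾱ-acc : ∀ {c x} → All (_≤ c) x → ∀ rec → maxLabel (ᾱ-acc x rec) ≤ c
maxLabel-ᾱ-acc {x = x} x≤c rec = maxLabel-least _ λ v →
  All.lookup x≤c (subst (label v ∈_) (α-ᾱ-acc x rec) (label∈α v))

-- Letters before the leftmost maximum are at most the maximum and differ from it, hence are
-- strictly smaller; letters after it are only weakly bounded.
ᾱ-acc-decreasing : ∀ {x} → All (1 ≤_) x → ∀ rec →
  Decreasing (ᾱ-acc x rec) × StrictlyDecreasingLeft (ᾱ-acc x rec)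
ᾱ-acc-decreasing {[]}       _   _         = tt , tt
ᾱ-acc-decreasing {x@(b ∷ x′)} 1≤x (acc rec) with leftmostMax b x′
... | i , i-min =
  let decL , sdlL = ᾱ-acc-decreasing (All.take⁺ (toℕ i) 1≤x) (rec (length-take-< x i))
      decR , sdlR = ᾱ-acc-decreasing (All.drop⁺ (suc (toℕ i)) 1≤x) (rec (length-drop-< b x′ (toℕ i)))
      x≤  = subst (λ k → All (_≤ k) x) (sym (proj₁ i-min)) (letters≤maximum x)
      L≢  = subst (λ k → All (_≢ k) (take (toℕ i) x)) (sym (proj₁ i-min)) (before-leftmost x i-min)
      L<  = All.zipWith (λ (≤max , ≢max) → ≤∧≢⇒< ≤max ≢max) (All.take⁺ (toℕ i) x≤ , L≢)
      maxL< = maxLabel-< (All.lookup 1≤x (∈-lookup i)) L< (rec (length-take-< x i))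
      maxR≤ = maxLabel-ᾱ-acc (All.drop⁺ (suc (toℕ i)) x≤) (rec (length-drop-< b x′ (toℕ i)))
  in (decL , decR , ⊔-lub (<⇒≤ maxL<) maxR≤) , (maxL< , sdlL , sdlR)
  where
  -- The empty subtree has maximal label 0, hence the need for positive letters.
  maxLabel-< : ∀ {c l} → 1 ≤ c → All (_< c) l → ∀ rec → maxLabel (ᾱ-acc l rec) < c
  maxLabel-< {suc c} _ l<c rec = s≤s (maxLabel-ᾱ-acc (All.map s≤s⁻¹ l<c) rec)

-- Fishburn trees and modified ascent sequences

-- The condition on positions inside `asctopsᵂ`, freed from the value coordinate that only records
-- the letter.
IsAscentTop : (x : Word) → Pred (Fin (length x)) _
IsAscentTop x i = toℕ i ≡ 0 ⊎ (∃ λ i′ → toℕ i ≡ suc (toℕ i′) × lookup x i′ < lookup x i)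

predecessor : ∀ {n} (i : Fin n) → toℕ i ≡ 0 ⊎ ∃ λ (i′ : Fin n) → toℕ i ≡ suc (toℕ i′)
predecessor zero    = inj₁ refl
predecessor (suc i) = inj₂ (Fin.inject₁ i , cong suc (sym (Fin.toℕ-inject₁ i)))

module _ (T : LTree) where

  private
    -- Positions in the word and in the traversal have propositionally equal but distinct index
    -- types; the casts `↓` and `↑` preserve the numerical position.
    ↓ : Fin (length (α T)) → Fin (length (inorder T))
    ↓ = cast (length-map label (inorder T))

    ↑ : Fin (length (inorder T)) → Fin (length (α T))
    ↑ = cast (sym (length-map label (inorder T)))

    toℕ-↓ : ∀ i → toℕ (↓ i) ≡ toℕ i
    toℕ-↓ = Fin.toℕ-cast _

    toℕ-↑ : ∀ i → toℕ (↑ i) ≡ toℕ i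
    toℕ-↑ = Fin.toℕ-cast _

    ↓↑ : ∀ i → ↓ (↑ i) ≡ i
    ↓↑ = Fin.cast-involutive (length-map label (inorder T)) (sym (length-map label (inorder T)))

  nodeAt : Fin (length (α T)) → Node T
  nodeAt i = visited T (↓ i)

  lookup-α : ∀ i → lookup (α T) i ≡ label (nodeAt i)
  lookup-α = lookup-map label (inorder T)

  nodeAt-surjective : ∀ v → ∃ λ i → nodeAt i ≡ v
  nodeAt-surjective v =
    ↑ (index v∈) , trans (cong (visited T) (↓↑ _)) (sym (lookup-index v∈))
    where v∈ = ∈-inorder v

  visited-injective : ∀ {i j} → visited T i ≡ visited T j → i ≡ j
  visited-injective = lookup-injective (inorder-unique T)

  lookup-α-↑ : ∀ i → lookup (α T) (↑ i) ≡ label (visited T i)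
  lookup-α-↑ i = trans (lookup-α (↑ i)) (cong (label ∘ visited T) (↓↑ i))

  -- The two sides are contrapositives: no earlier node shares the label, and no position of an
  -- equal letter is earlier.
  nubᵀ⇔leftmost : ∀ i → nubᵀ T (nodeAt i) ⇔ IsMin (fibre (α T) (lookup (α T) i)) i
  nubᵀ⇔leftmost i = mk⇔ ⇒ ⇐
    where
    ⇒ : nubᵀ T (nodeAt i) → IsMin (fibre (α T) (lookup (α T) i)) i
    -- Each node is visited once, so the position `j` witnessing `nubᵀ` must be `↓ i`.
    ⇒ (j , j≡ , new) with refl ← visited-injective {j} {↓ i} j≡ = refl , λ {i′} i′∈ → ≮⇒≥ λ i′<i →
      new (↓ i′) (subst₂ _<_ (sym (toℕ-↓ i′)) (sym (toℕ-↓ i)) i′<i)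
        (trans (sym (lookup-α i′)) (trans i′∈ (lookup-α i)))

    ⇐ : IsMin (fibre (α T) (lookup (α T) i)) i → nubᵀ T (nodeAt i)
    ⇐ (_ , least) = ↓ i , refl , λ j j<i label≡ →
      <⇒≱ (subst₂ _<_ (sym (toℕ-↑ j)) (toℕ-↓ i) j<i)
          (least (trans (lookup-α-↑ j) (trans label≡ (sym (lookup-α i)))))

  module _ (dec : Decreasing T) (sdl : StrictlyDecreasingLeft T) where

    private
      ascent : ∀ {i j} → toℕ j ≡ suc (toℕ i) →
        HasLeftChild (nodeAt j) ⇔ lookup (α T) i < lookup (α T) j
      ascent {i} {j} eq rewrite lookup-α i | lookup-α j =
        linked-lookup (adjacent-ascent T dec sdl)
          (trans (toℕ-↓ j) (trans eq (cong suc (sym (toℕ-↓ i)))))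

    -- The first position belongs to both sides by definition; every other one has a predecessor,
    -- where `adjacent-ascent` applies.
    asctopsᵀ⇔IsAscentTop : ∀ i → asctopsᵀ T (nodeAt i) ⇔ IsAscentTop (α T) i
    asctopsᵀ⇔IsAscentTop i = mk⇔ ⇒ ⇐
      where
      ⇒ : asctopsᵀ T (nodeAt i) → IsAscentTop (α T) i
      ⇒ (inj₁ (j , j≡0 , eq)) with refl ← visited-injective {j} {↓ i} eq =
        inj₁ (trans (sym (toℕ-↓ i)) j≡0)
      ⇒ (inj₂ hasLeft) with predecessor i
      ... | inj₁ i≡0       = inj₁ i≡0
      ... | inj₂ (i′ , eq) = inj₂ (i′ , eq , to (ascent eq) hasLeft)

      ⇐ : IsAscentTop (α T) i → asctopsᵀ T (nodeAt i)
      ⇐ (inj₁ i≡0)             = inj₁ (↓ i , trans (toℕ-↓ i) i≡0 , refl)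
      ⇐ (inj₂ (i′ , eq , asc)) = inj₂ (from (ascent eq) asc)

    module _ (positive : All (1 ≤_) (α T)) where

      -- Positions are compared through the two equivalences above; `positive` and `letters≤maximum`
      -- supply the range of values that `nubᵂ` demands.
      asctopsᵂ≐nubᵂ : nubᵀ T ≐ asctopsᵀ T → asctopsᵂ (α T) ≐ nubᵂ (α T)
      asctopsᵂ≐nubᵂ (nub⊆ , asc⊆)
        = (λ { {i , _} (refl , asc) →
                 (All.lookup positive (∈-lookup i) , All.lookup (letters≤maximum (α T)) (∈-lookup i))
               , to (nubᵀ⇔leftmost i) (asc⊆ (from (asctopsᵀ⇔IsAscentTop i) asc)) })
        , (λ { {i , _} (_ , refl , least) →
                 refl , to (asctopsᵀ⇔IsAscentTop i)
                          (nub⊆ (from (nubᵀ⇔leftmost i) (refl , least))) })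

      nubᵀ≐asctopsᵀ : asctopsᵂ (α T) ≐ nubᵂ (α T) → nubᵀ T ≐ asctopsᵀ T
      nubᵀ≐asctopsᵀ (asc⊆ , nub⊆) = forth , back
        where
        forth : nubᵀ T ⊆ asctopsᵀ T
        forth {v} new with i , refl ← nodeAt-surjective v =
          from (asctopsᵀ⇔IsAscentTop i) (proj₂ (nub⊆ {i , _}
            ( (All.lookup positive (∈-lookup i) , All.lookup (letters≤maximum (α T)) (∈-lookup i))
            , to (nubᵀ⇔leftmost i) new)))

        back : asctopsᵀ T ⊆ nubᵀ T
        back {v} asc with i , refl ← nodeAt-surjective v =
          from (nubᵀ⇔leftmost i) (proj₂ (asc⊆ {i , _} (refl , to (asctopsᵀ⇔IsAscentTop i) asc)))

-- Membership of the images in `𝒜̂` and `𝒯`.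

α-∈ : 𝒯 ⊆ α ⊢ 𝒜̂
α-∈ {T} ((dec , sdl , _) , (k , k≤ , Labels⊆ , ⊆Labels) , nub≐asc) =
  (k , subst (k ≤_) (sym (length-α T)) k≤ , Labels⊆ ∘ α⊆ , ⊆α ∘ ⊆Labels) ,
  asctopsᵂ≐nubᵂ T dec sdl (All.tabulate (proj₁ ∘ Labels⊆ ∘ α⊆)) nub≐asc
  where
  α⊆ : (_∈ α T) ⊆ Labels T
  α⊆ = proj₂ (Labels≐α T)
  ⊆α : Labels T ⊆ (_∈ α T)
  ⊆α = proj₁ (Labels≐α T)

-- Applied to `ᾱ x`, this reduces membership in `𝒯` to the shape of the tree, since its in-order
-- word is `x` again.
α⁻¹-∈ : ∀ T → Decreasing T → StrictlyDecreasingLeft T → 𝒜̂ (α T) → 𝒯 T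
α⁻¹-∈ T dec sdl ((k , k≤ , α⊆ , ⊆α) , asc≐nub) =
  (dec , sdl , Product.map₂ (λ j≤k → ≤-trans j≤k k≤#) ∘ α⊆ ∘ proj₁ (Labels≐α T)) ,
  (k , k≤# , α⊆ ∘ proj₁ (Labels≐α T) , proj₂ (Labels≐α T) ∘ ⊆α) ,
  nubᵀ≐asctopsᵀ T dec sdl (All.tabulate (proj₁ ∘ α⊆)) asc≐nub
  where
  k≤# : k ≤ #nodes T
  k≤# = subst (k ≤_) (length-α T) k≤

ᾱ-∈ : 𝒜̂ ⊆ ᾱ ⊢ 𝒯
ᾱ-∈ {x} x∈@((_ , _ , x⊆ , _) , _) =
  let dec , sdl = ᾱ-acc-decreasing (All.tabulate (proj₁ ∘ x⊆)) (<-wellFounded (length x))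
  in α⁻¹-∈ (ᾱ x) dec sdl (subst 𝒜̂ (sym (α-ᾱ x)) x∈)

-- Finiteness

IsCayley? : Decidable IsCayley
IsCayley? x = map′
  (λ (k , k< , values) → k , s≤s⁻¹ k< , values)
  (λ (k , k≤ , values) → k , s≤s k≤ , values)
  -- The search runs strictly below its bound, so `suc` admits `k` equal to the length.
  (anyUpTo? values? (suc (length x)))
  where
  ⊇? : ∀ k → Dec ([1… k ] ⊆ (_∈ x))
  ⊇? k = map′ ⇒ (λ ⊇ {j} j<k → ⊇ (s≤s z≤n , j<k)) (allUpTo? (λ j → _∈?_ _≟_ (suc j) x) k)
    where
    ⇒ : (∀ {j} → j < k → suc j ∈ x) → [1… k ] ⊆ (_∈ x)
    ⇒ h {suc j} (_ , j<k) = h j<k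

  values? : ∀ k → Dec ((_∈ x) ≐ [1… k ])
  values? k =
    map′ (λ all → All.lookup all) (λ ⊆ → All.tabulate ⊆)
      (All.all? (λ j → (1 ≤? j) ×-dec (j ≤? k)) x)
    ×-dec ⊇? k

-- The second coordinate may range over an infinite type, but `P` lies in the graph of `f`, so only
-- the finitely many pairs `(i , f i)` need testing.
graph-⊆? : ∀ {n} (f : Fin n → A) {P : Pred (Fin n × A) p} {Q : Pred (Fin n × A) q} →
  (∀ {i j} → P (i , j) → f i ≡ j) → Decidable P → Decidable Q → Dec (P ⊆ Q)
graph-⊆? f {P} {Q} graph P? Q? = map′ ⇒ (λ P⊆Q i → P⊆Q)
  (Fin.all? λ i → P? (i , f i) →-dec Q? (i , f i))
  where
  ⇒ : (∀ i → P (i , f i) → Q (i , f i)) → P ⊆ Q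
  ⇒ h {i , j} Pij with refl ← graph Pij = h i Pij

asctopsᵂ? : ∀ x → Decidable (asctopsᵂ x)
asctopsᵂ? x (i , j) = (lookup x i ≟ j) ×-dec ((toℕ i ≟ 0) ⊎-dec
  Fin.any? λ i′ → (toℕ i ≟ suc (toℕ i′)) ×-dec (lookup x i′ <? lookup x i))

nubᵂ? : ∀ x → Decidable (nubᵂ x)
nubᵂ? x (i , j) = ((1 ≤? j) ×-dec (j ≤? maximum x)) ×-dec (lookup x i ≟ j) ×-dec
  map′ (λ least {i′} → least i′) (λ least i′ → least {i′})
    (Fin.all? λ i′ → (lookup x i′ ≟ j) →-dec (i Fin.≤? i′))

𝒜̂? : Decidable 𝒜̂
𝒜̂? x = IsCayley? x ×-dec
  graph-⊆? (lookup x) proj₁ (asctopsᵂ? x) (nubᵂ? x) ×-dec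
  graph-⊆? (lookup x) (proj₁ ∘ proj₂) (nubᵂ? x) (asctopsᵂ? x)

-- Letters run from 0 to `k`; a finite superset suffices, as it is filtered afterwards.
words : ℕ → ℕ → List Word
words k zero    = [] ∷ []
words k (suc n) = cartesianProductWith _∷_ (upTo (suc k)) (words k n)

∈-words : ∀ {k x} → All (_≤ k) x → x ∈ words k (length x)
∈-words []          = here refl
∈-words (b≤k ∷ x≤k) = ∈-cartesianProductWith⁺ _∷_ (∈-upTo⁺ (s≤s b≤k)) (∈-words x≤k)

-- Deduplicating and filtering `xs` lists each element of `P` exactly once, so `index` and `lookup`
-- are inverse up to membership proofs.
finite : DecidableEquality A → {P : Pred A p} → Decidable P →
  (xs : List A) → P ⊆ (_∈ xs) → ∃ (HasCardinality P)
finite _≟ᴬ_ {P} P? xs P⊆xs = length ys , record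
  { to        = λ (_ , Px) → index (∈ys Px)
  ; from      = λ i → lookup ys i , ys⊆P (∈-lookup i)
  ; to-cong   = λ { {_ , Px} {_ , Py} x≡y → lookup-injective ys-unique
                    (trans (sym (lookup-index (∈ys Px))) (trans x≡y (lookup-index (∈ys Py)))) }
  ; from-cong = cong (lookup ys)
  ; inverse   = (λ { {_} {_ , Py} y≡ → lookup-injective ys-unique
                     (trans (sym (lookup-index (∈ys Py))) y≡) })
              , (λ { {_ , Px} refl → sym (lookup-index (∈ys Px)) })
  }
  where
  ys = filter P? (deduplicate _≟ᴬ_ xs)

  ys-unique : Unique ys
  ys-unique = Unique.filter⁺ P? (deduplicate-! _≟ᴬ_ xs)

  ∈ys : P ⊆ (_∈ ys)
  ∈ys Px = ∈-filter⁺ P? (∈-deduplicate⁺ _≟ᴬ_ (P⊆xs Px)) Px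

  ys⊆P : (_∈ ys) ⊆ P
  ys⊆P = proj₂ ∘ ∈-filter⁻ P? {xs = deduplicate _≟ᴬ_ xs}

𝒜̂ₙ-finite : ∀ n → ∃ (HasCardinality (𝒜̂ₙ n))
𝒜̂ₙ-finite n = finite (≡-dec _≟_) (λ x → 𝒜̂? x ×-dec (length x ≟ n)) (words n n)
  λ { (((_ , k≤n , x⊆ , _) , _) , refl) →
        ∈-words (All.tabulate λ j∈ → ≤-trans (proj₂ (x⊆ j∈)) k≤n) }

-- The bijections and the equality of cardinalities.

α-ᾱ-inverse : Inverseᵇ (_≋_ {P = 𝒯}) (_≋_ {P = 𝒜̂}) (Product.map α α-∈) (Product.map ᾱ ᾱ-∈)
α-ᾱ-inverse =
  (λ { {x , _} {_ , _} refl → α-ᾱ x }) ,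
  (λ { {T , (dec , sdl , _) , _} {_ , _} refl → ᾱ-α T dec sdl })

#nodes-ᾱ : ∀ x → #nodes (ᾱ x) ≡ length x
#nodes-ᾱ x = trans (sym (length-α (ᾱ x))) (cong length (α-ᾱ x))

𝒯ₙ↔𝒜̂ₙ : ∀ n → Inverse (subsetoid (𝒯ₙ n)) (subsetoid (𝒜̂ₙ n))
𝒯ₙ↔𝒜̂ₙ n = record
  { to        = Product.map α λ {T} (T∈ , size) → α-∈ T∈ , trans (length-α T) size
  ; from      = Product.map ᾱ λ {x} (x∈ , size) → ᾱ-∈ x∈ , trans (#nodes-ᾱ x) size
  ; to-cong   = cong α
  ; from-cong = cong ᾱ
  ; inverse   = (λ { {_ , x∈ , _} {_ , T∈ , _} → proj₁ α-ᾱ-inverse {_ , x∈} {_ , T∈} })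
              , (λ { {_ , T∈ , _} {_ , x∈ , _} → proj₂ α-ᾱ-inverse {_ , T∈} {_ , x∈} })
  }

corollary4p5 : (Σ[ α∈ ∈ 𝒯 ⊆ α ⊢ 𝒜̂ ] Σ[ ᾱ∈ ∈ 𝒜̂ ⊆ ᾱ ⊢ 𝒯 ]
    ( Bijective (_≋_ {P = 𝒯}) (_≋_ {P = 𝒜̂}) (Product.map α α∈)
    × Bijective (_≋_ {P = 𝒜̂}) (_≋_ {P = 𝒯}) (Product.map ᾱ ᾱ∈)
    × Inverseᵇ (_≋_ {P = 𝒯}) (_≋_ {P = 𝒜̂}) (Product.map α α∈) (Product.map ᾱ ᾱ∈) ))
    × (∀ T → 𝒯 T → length (α T) ≡ #nodes T)
    × (∀ x → 𝒜̂ x → #nodes (ᾱ x) ≡ length x)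
    × (∀ n → 1 ≤ n → ∃ λ N → HasCardinality (𝒯ₙ n) N × HasCardinality (𝒜̂ₙ n) N)
corollary4p5 =
  ( α-∈ , ᾱ-∈
  , inverseᵇ⇒bijective {f = Product.map α α-∈} {f⁻¹ = Product.map ᾱ ᾱ-∈} _≋_ refl sym trans α-ᾱ-inverse
  , inverseᵇ⇒bijective {f = Product.map ᾱ ᾱ-∈} {f⁻¹ = Product.map α α-∈} _≋_ refl sym trans (Product.swap α-ᾱ-inverse)
  , α-ᾱ-inverse )
  , (λ T _ → length-α T)
  , (λ x _ → #nodes-ᾱ x)
  -- Only the sequences are enumerated; the size-preserving bijection carries their count to the
  -- trees.
  , λ n _ → let N , 𝒜̂ₙ↔Fin = 𝒜̂ₙ-finite n in
      N , inverse (𝒯ₙ↔𝒜̂ₙ n) 𝒜̂ₙ↔Fin , 𝒜̂ₙ↔Fin
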